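{- There exists a finite set of points $X \subset \mathbb{R}^2$ together with a point $x \in X$ and a noncrossing tour $T$ through $X \setminus \{x\}$ (i.e., through all but one of the points) such that every noncrossing tour through all points of $X$ has length strictly less than $\ell(T)$.
   Context: For a finite set of points in $\mathbb{R}^2$, a tour is a Hamiltonian cycle on them; the length of an edge $\{a,b\}$ is the Euclidean distance $d(a,b)$ and $\ell(T)$ is the sum of the edge lengths of $T$. For an edge $e=\{a,b\}$, $L(e)$ denotes the closed line segment from $a$ to $b$. A tour is noncrossing if no two of its edges have intersecting line segments (other than at a shared endpoint). -}

module Defs where

open import Data.Fin.Base using (Fin; suc; toℕ)
open import Data.Fin.Permutation using (Permutation′; _⟨$⟩ʳ_)
open import Data.Fin.Properties using (punchIn-injective)
open import Data.Integer.Base as ℤ using (ℤ; +_; -[1+_])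
import Data.Integer.DivMod as ℤ
import Data.Integer.Properties as ℤ
open import Data.Nat.Base as ℕ using (ℕ; zero; suc)
open import Data.Nat.DivMod using (_mod_)
import Data.Nat.Properties as ℕ
open import Data.Product using (_×_; _,_; ∃-syntax)
open import Data.Rational.Base as ℚ using (ℚ; mkℚ; 0ℚ; 1ℚ; ½; toℚᵘ)
import Data.Rational.Properties as ℚ
import Data.Rational.Solver as ℚ
open import Data.Rational.Unnormalised.Base as ℚᵘ using (mkℚᵘ)
import Data.Rational.Unnormalised.Properties as ℚᵘ
open import Data.Sum.Base using (_⊎_; inj₁; inj₂)
open import Data.Vec.Functional using (Vector; foldr; removeAt)
open import Function.Base using (_∘_)
open import Relation.Binary.PropositionalEquality
  using (_≡_; _≢_; refl; sym; trans; cong; cong₂; subst; subst₂)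
open import Relation.Nullary using (¬_; yes; no)

open ℚ.+-*-Solver using (solve; _:+_; _:-_; _:*_; :-_; _:=_)

------------------------------------------------------------------------
-- Real numbers

-- The reals are Cauchy sequences of rationals, each with a modulus of
-- convergence, under the setoid equality _≃_ below.

IsCauchy : (ℕ → ℚ) → Set
IsCauchy x = ∀ ε → 0ℚ ℚ.< ε →
  ∃[ N ] (∀ m n → N ℕ.≤ m → N ℕ.≤ n → ℚ.∣ x m ℚ.- x n ∣ ℚ.< ε)

record ℝ : Set where
  constructor mkℝ
  field
    seq    : ℕ → ℚ
    cauchy : IsCauchy seq

open ℝ public

infix 4 _≃_ _<_ _≤_

_≃_ : ℝ → ℝ → Set
x ≃ y = ∀ ε → 0ℚ ℚ.< ε →
  ∃[ N ] (∀ n → N ℕ.≤ n → ℚ.∣ seq x n ℚ.- seq y n ∣ ℚ.< ε)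

_<_ : ℝ → ℝ → Set
x < y = ∃[ ε ] (0ℚ ℚ.< ε ×
  ∃[ N ] (∀ n → N ℕ.≤ n → seq x n ℚ.+ ε ℚ.≤ seq y n))

_≤_ : ℝ → ℝ → Set
x ≤ y = ¬ (y < x)

private

  ½*-pos : ∀ {ε} → 0ℚ ℚ.< ε → 0ℚ ℚ.< ½ ℚ.* ε
  ½*-pos {ε} 0<ε = subst (ℚ._< ½ ℚ.* ε) (ℚ.*-zeroʳ ½) (ℚ.*-monoʳ-<-pos ½ 0<ε)

  ½+½ : ∀ ε → ½ ℚ.* ε ℚ.+ ½ ℚ.* ε ≡ ε
  ½+½ ε = trans (sym (ℚ.*-distribʳ-+ ε ½ ½)) (ℚ.*-identityˡ ε)

  p≤∣p∣ : ∀ p → p ℚ.≤ ℚ.∣ p ∣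
  p≤∣p∣ p with ℚ.≤-total 0ℚ p
  ... | inj₁ 0≤p = ℚ.≤-reflexive (sym (ℚ.0≤p⇒∣p∣≡p 0≤p))
  ... | inj₂ p≤0 = ℚ.≤-trans p≤0 (ℚ.0≤∣p∣ p)

  ∣p-q∣≡∣q-p∣ : ∀ p q → ℚ.∣ p ℚ.- q ∣ ≡ ℚ.∣ q ℚ.- p ∣
  ∣p-q∣≡∣q-p∣ p q = trans (sym (ℚ.∣-p∣≡∣p∣ (p ℚ.- q)))
    (cong ℚ.∣_∣ (solve 2 (λ p q → :- (p :- q) := q :- p) refl p q))

  ∣p-q∣<ε : ∀ p q ε → p ℚ.< q ℚ.+ ε → q ℚ.< p ℚ.+ ε → ℚ.∣ p ℚ.- q ∣ ℚ.< ε
  ∣p-q∣<ε p q ε p<q+ε q<p+ε with ℚ.∣p∣≡p∨∣p∣≡-p (p ℚ.- q)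
  ... | inj₁ eq = subst₂ ℚ._<_ (sym eq)
    (solve 2 (λ q ε → (q :+ ε) :- q := ε) refl q ε)
    (ℚ.+-monoˡ-< (ℚ.- q) p<q+ε)
  ... | inj₂ eq = subst₂ ℚ._<_
    (trans (solve 2 (λ p q → q :- p := :- (p :- q)) refl p q) (sym eq))
    (solve 2 (λ p ε → (p :+ ε) :- p := ε) refl p ε)
    (ℚ.+-monoˡ-< (ℚ.- p) q<p+ε)

fromℚ : ℚ → ℝ
fromℚ q = mkℝ (λ _ → q) λ ε 0<ε →
  0 , λ _ _ _ _ → subst (ℚ._< ε) (cong ℚ.∣_∣ (sym (ℚ.+-inverseʳ q))) 0<ε

0ℝ 1ℝ : ℝ
0ℝ = fromℚ 0ℚ
1ℝ = fromℚ 1ℚ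

infixl 6 _+_ _-_
infixl 7 _*_
infix  8 -_

_+_ : ℝ → ℝ → ℝ
x + y = mkℝ (λ n → seq x n ℚ.+ seq y n) +-cauchy
  where
  +-cauchy : IsCauchy (λ n → seq x n ℚ.+ seq y n)
  +-cauchy ε 0<ε =
    let δ        = ½ ℚ.* ε
        (M , cx) = cauchy x δ (½*-pos 0<ε)
        (N , cy) = cauchy y δ (½*-pos 0<ε)
    in M ℕ.⊔ N , λ m n h k → begin-strict
      ℚ.∣ (seq x m ℚ.+ seq y m) ℚ.- (seq x n ℚ.+ seq y n) ∣
        ≡⟨ cong ℚ.∣_∣ (solve 4
             (λ a b c d → (a :+ b) :- (c :+ d) := (a :- c) :+ (b :- d))
             refl (seq x m) (seq y m) (seq x n) (seq y n)) ⟩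
      ℚ.∣ (seq x m ℚ.- seq x n) ℚ.+ (seq y m ℚ.- seq y n) ∣
        ≤⟨ ℚ.∣p+q∣≤∣p∣+∣q∣ (seq x m ℚ.- seq x n) (seq y m ℚ.- seq y n) ⟩
      ℚ.∣ seq x m ℚ.- seq x n ∣ ℚ.+ ℚ.∣ seq y m ℚ.- seq y n ∣
        <⟨ ℚ.+-mono-<
             (cx m n (ℕ.m⊔n≤o⇒m≤o M N h) (ℕ.m⊔n≤o⇒m≤o M N k))
             (cy m n (ℕ.m⊔n≤o⇒n≤o M N h) (ℕ.m⊔n≤o⇒n≤o M N k)) ⟩
      δ ℚ.+ δ ≡⟨ ½+½ ε ⟩
      ε ∎
    where open ℚ.≤-Reasoning

-_ : ℝ → ℝ
- x = mkℝ (λ n → ℚ.- seq x n) λ ε 0<ε →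
  let (N , cx) = cauchy x ε 0<ε
  in N , λ m n h k → subst (ℚ._< ε)
       (trans (∣p-q∣≡∣q-p∣ (seq x m) (seq x n)) (cong ℚ.∣_∣
         (solve 2 (λ a b → b :- a := (:- a) :- (:- b)) refl (seq x m) (seq x n))))
       (cx m n h k)

_-_ : ℝ → ℝ → ℝ
x - y = x + (- y)

private

  bounded : ∀ x → ∃[ B ] (0ℚ ℚ.< B ×
    ∃[ N ] (∀ n → N ℕ.≤ n → ℚ.∣ seq x n ∣ ℚ.≤ B))
  bounded x =
    let (N , cx) = cauchy x 1ℚ (ℚ.positive⁻¹ 1ℚ)
    in ℚ.∣ seq x N ∣ ℚ.+ 1ℚ
     , ℚ.+-mono-≤-< (ℚ.0≤∣p∣ (seq x N)) (ℚ.positive⁻¹ 1ℚ)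
     , N , λ n h → begin
         ℚ.∣ seq x n ∣
           ≡⟨ cong ℚ.∣_∣ (solve 2 (λ a b → a := b :+ (a :- b)) refl (seq x n) (seq x N)) ⟩
         ℚ.∣ seq x N ℚ.+ (seq x n ℚ.- seq x N) ∣
           ≤⟨ ℚ.∣p+q∣≤∣p∣+∣q∣ (seq x N) (seq x n ℚ.- seq x N) ⟩
         ℚ.∣ seq x N ∣ ℚ.+ ℚ.∣ seq x n ℚ.- seq x N ∣
           ≤⟨ ℚ.+-monoʳ-≤ ℚ.∣ seq x N ∣ (ℚ.<⇒≤ (cx n N h ℕ.≤-refl)) ⟩
         ℚ.∣ seq x N ∣ ℚ.+ 1ℚ ∎
    where open ℚ.≤-Reasoning

  -- If ∣p∣ ≤ B, then ∣q∣ < δ suffices for ∣p*q∣ < ε.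
  tolerance : ∀ B ε → 0ℚ ℚ.< B → 0ℚ ℚ.< ε → ∃[ δ ] (0ℚ ℚ.< δ ×
    (∀ p q → ℚ.∣ p ∣ ℚ.≤ B → ℚ.∣ q ∣ ℚ.< δ → ℚ.∣ p ℚ.* q ∣ ℚ.< ε))
  tolerance B ε 0<B 0<ε = δ , 0<δ , λ p q p≤B q<δ → begin-strict
      ℚ.∣ p ℚ.* q ∣
        ≡⟨ ℚ.∣p*q∣≡∣p∣*∣q∣ p q ⟩
      ℚ.∣ p ∣ ℚ.* ℚ.∣ q ∣
        ≤⟨ ℚ.*-monoʳ-≤-nonNeg ℚ.∣ q ∣ {{ℚ.∣-∣-nonNeg q}} p≤B ⟩
      B ℚ.* ℚ.∣ q ∣
        <⟨ ℚ.*-monoʳ-<-pos B q<δ ⟩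
      B ℚ.* δ
        ≡⟨ ℚ.*-assoc B (ℚ.1/ B) ε ⟨
      B ℚ.* ℚ.1/ B ℚ.* ε
        ≡⟨ cong (ℚ._* ε) (ℚ.*-inverseʳ B) ⟩
      1ℚ ℚ.* ε
        ≡⟨ ℚ.*-identityˡ ε ⟩
      ε ∎
    where
    open ℚ.≤-Reasoning
    instance
      B-pos = ℚ.positive 0<B
      B-nonZero = ℚ.pos⇒nonZero B
      ε-pos = ℚ.positive 0<ε
      1/B-pos = ℚ.1/pos⇒pos B
    δ = ℚ.1/ B ℚ.* ε
    0<δ = ℚ.positive⁻¹ δ {{ℚ.pos*pos⇒pos (ℚ.1/ B) ε}}

_*_ : ℝ → ℝ → ℝ
x * y = mkℝ (λ n → seq x n ℚ.* seq y n) *-cauchy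
  where
  *-cauchy : IsCauchy (λ n → seq x n ℚ.* seq y n)
  *-cauchy ε 0<ε =
    let ½ε = ½ ℚ.* ε
        (A , 0<A , K , x≤A) = bounded x
        (B , 0<B , L , y≤B) = bounded y
        (δ , 0<δ , δ-ok)    = tolerance A ½ε 0<A (½*-pos 0<ε)
        (η , 0<η , η-ok)    = tolerance B ½ε 0<B (½*-pos 0<ε)
        (M , cy)            = cauchy y δ 0<δ
        (N , cx)            = cauchy x η 0<η
        KL = K ℕ.⊔ L
        MN = M ℕ.⊔ N
        K≤ : ∀ {o} → KL ℕ.⊔ MN ℕ.≤ o → K ℕ.≤ o
        K≤ h = ℕ.m⊔n≤o⇒m≤o K L (ℕ.m⊔n≤o⇒m≤o KL MN h)
        L≤ : ∀ {o} → KL ℕ.⊔ MN ℕ.≤ o → L ℕ.≤ o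
        L≤ h = ℕ.m⊔n≤o⇒n≤o K L (ℕ.m⊔n≤o⇒m≤o KL MN h)
        M≤ : ∀ {o} → KL ℕ.⊔ MN ℕ.≤ o → M ℕ.≤ o
        M≤ h = ℕ.m⊔n≤o⇒m≤o M N (ℕ.m⊔n≤o⇒n≤o KL MN h)
        N≤ : ∀ {o} → KL ℕ.⊔ MN ℕ.≤ o → N ℕ.≤ o
        N≤ h = ℕ.m⊔n≤o⇒n≤o M N (ℕ.m⊔n≤o⇒n≤o KL MN h)
    in KL ℕ.⊔ MN , λ m n h k → begin-strict
      ℚ.∣ seq x m ℚ.* seq y m ℚ.- seq x n ℚ.* seq y n ∣
        ≡⟨ cong ℚ.∣_∣ (solve 4
             (λ a b c d → a :* b :- c :* d := a :* (b :- d) :+ d :* (a :- c))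
             refl (seq x m) (seq y m) (seq x n) (seq y n)) ⟩
      ℚ.∣ seq x m ℚ.* (seq y m ℚ.- seq y n) ℚ.+ seq y n ℚ.* (seq x m ℚ.- seq x n) ∣
        ≤⟨ ℚ.∣p+q∣≤∣p∣+∣q∣ (seq x m ℚ.* (seq y m ℚ.- seq y n))
                           (seq y n ℚ.* (seq x m ℚ.- seq x n)) ⟩
      ℚ.∣ seq x m ℚ.* (seq y m ℚ.- seq y n) ∣ ℚ.+ ℚ.∣ seq y n ℚ.* (seq x m ℚ.- seq x n) ∣
        <⟨ ℚ.+-mono-<
             (δ-ok (seq x m) (seq y m ℚ.- seq y n) (x≤A m (K≤ h))
                   (cy m n (M≤ h) (M≤ k)))
             (η-ok (seq y n) (seq x m ℚ.- seq x n) (y≤B n (L≤ k))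
                   (cx m n (N≤ h) (N≤ k))) ⟩
      ½ε ℚ.+ ½ε ≡⟨ ½+½ ε ⟩
      ε ∎
    where open ℚ.≤-Reasoning

------------------------------------------------------------------------
-- Square roots

-- ⌊√n⌋
sqrtℕ : ℕ → ℕ
sqrtℕ zero    = zero
sqrtℕ (suc n) with suc (sqrtℕ n) ℕ.* suc (sqrtℕ n) ℕ.≤? suc n
... | yes _ = suc (sqrtℕ n)
... | no  _ = sqrtℕ n

-- The largest multiple of 1/(k+1) whose square is at most max(q,0).
sqrtℚ : ℕ → ℚ → ℚ
sqrtℚ k q = + sqrtℕ ℤ.∣ ℚ.⌊ (q ℚ.⊔ 0ℚ) ℚ.* (c ℚ.* c) ⌋ ∣ ℚ./ suc k
  where c = + suc k ℚ./ 1

sqrtℕ-lower : ∀ n → sqrtℕ n ℕ.* sqrtℕ n ℕ.≤ n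
sqrtℕ-lower zero    = ℕ.z≤n
sqrtℕ-lower (suc n) with suc (sqrtℕ n) ℕ.* suc (sqrtℕ n) ℕ.≤? suc n
... | yes h = h
... | no  _ = ℕ.m≤n⇒m≤1+n (sqrtℕ-lower n)

sqrtℕ-upper : ∀ n → suc n ℕ.≤ suc (sqrtℕ n) ℕ.* suc (sqrtℕ n)
sqrtℕ-upper zero    = ℕ.s≤s ℕ.z≤n
sqrtℕ-upper (suc n) with suc (sqrtℕ n) ℕ.* suc (sqrtℕ n) ℕ.≤? suc n
... | yes h = ℕ.<-≤-trans (ℕ.s≤s (sqrtℕ-upper n))
                (ℕ.*-mono-< (ℕ.n<1+n (suc (sqrtℕ n))) (ℕ.n<1+n (suc (sqrtℕ n))))
... | no ¬h = ℕ.≰⇒> ¬h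

private

  toℚᵘ-/ : ∀ i k → toℚᵘ (i ℚ./ suc k) ℚᵘ.≃ mkℚᵘ i k
  toℚᵘ-/ i k = ℚ.toℚᵘ-fromℚᵘ (mkℚᵘ i k)

  ι : ℤ → ℚ
  ι i = i ℚ./ 1

  ι-+ : ∀ i j → ι (i ℤ.+ j) ≡ ι i ℚ.+ ι j
  ι-+ i j = ℚ.toℚᵘ-injective (begin
    toℚᵘ (ι (i ℤ.+ j))            ≈⟨ toℚᵘ-/ (i ℤ.+ j) 0 ⟩
    mkℚᵘ (i ℤ.+ j) 0              ≈⟨ ℚᵘ.*≡* (cong (ℤ._* + 1) (cong₂ ℤ._+_ (sym (ℤ.*-identityʳ i)) (sym (ℤ.*-identityʳ j)))) ⟩
    mkℚᵘ i 0 ℚᵘ.+ mkℚᵘ j 0        ≈⟨ ℚᵘ.+-cong (toℚᵘ-/ i 0) (toℚᵘ-/ j 0) ⟨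
    toℚᵘ (ι i) ℚᵘ.+ toℚᵘ (ι j)    ≈⟨ ℚ.toℚᵘ-homo-+ (ι i) (ι j) ⟨
    toℚᵘ (ι i ℚ.+ ι j)            ∎)
    where open ℚᵘ.≃-Reasoning

  ι-* : ∀ i j → ι (i ℤ.* j) ≡ ι i ℚ.* ι j
  ι-* i j = ℚ.toℚᵘ-injective (begin
    toℚᵘ (ι (i ℤ.* j))            ≈⟨ toℚᵘ-/ (i ℤ.* j) 0 ⟩
    mkℚᵘ (i ℤ.* j) 0              ≈⟨ ℚᵘ.*-cong (toℚᵘ-/ i 0) (toℚᵘ-/ j 0) ⟨
    toℚᵘ (ι i) ℚᵘ.* toℚᵘ (ι j)    ≈⟨ ℚ.toℚᵘ-homo-* (ι i) (ι j) ⟨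
    toℚᵘ (ι i ℚ.* ι j)            ∎)
    where open ℚᵘ.≃-Reasoning

  ι-mono-≤ : ∀ {i j} → i ℤ.≤ j → ι i ℚ.≤ ι j
  ι-mono-≤ {i} {j} i≤j = ℚ.toℚᵘ-cancel-≤
    (ℚᵘ.≤-respˡ-≃ (ℚᵘ.≃-sym (toℚᵘ-/ i 0)) (ℚᵘ.≤-respʳ-≃ (ℚᵘ.≃-sym (toℚᵘ-/ j 0))
      (ℚᵘ.*≤* (ℤ.*-monoʳ-≤-nonNeg (+ 1) i≤j))))

  /-*-cancel : ∀ i k → (i ℚ./ suc k) ℚ.* ι (+ suc k) ≡ ι i
  /-*-cancel i k = ℚ.toℚᵘ-injective (begin
    toℚᵘ ((i ℚ./ suc k) ℚ.* ι (+ suc k))          ≈⟨ ℚ.toℚᵘ-homo-* (i ℚ./ suc k) (ι (+ suc k)) ⟩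
    toℚᵘ (i ℚ./ suc k) ℚᵘ.* toℚᵘ (ι (+ suc k))    ≈⟨ ℚᵘ.*-cong (toℚᵘ-/ i k) (toℚᵘ-/ (+ suc k) 0) ⟩
    mkℚᵘ i k ℚᵘ.* mkℚᵘ (+ suc k) 0                ≈⟨ ℚᵘ.*≡* (trans (ℤ.*-identityʳ _) (cong (λ n → i ℤ.* + n) (sym (ℕ.*-identityʳ (suc k))))) ⟩
    mkℚᵘ i 0                                      ≈⟨ toℚᵘ-/ i 0 ⟨
    toℚᵘ (ι i)                                    ∎)
    where open ℚᵘ.≃-Reasoning

  floor-lower : ∀ q → ι ℚ.⌊ q ⌋ ℚ.≤ q
  floor-lower q@(mkℚ i d _) = ℚ.toℚᵘ-cancel-≤
    (ℚᵘ.≤-respˡ-≃ (ℚᵘ.≃-sym (toℚᵘ-/ ℚ.⌊ q ⌋ 0))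
      (ℚᵘ.*≤* (ℤ.≤-trans (ℤ.[n/d]*d≤n i (+ suc d)) (ℤ.≤-reflexive (sym (ℤ.*-identityʳ i))))))

  floor-upper : ∀ q → q ℚ.< ι (ℚ.⌊ q ⌋ ℤ.+ + 1)
  floor-upper q@(mkℚ i d _) = ℚ.toℚᵘ-cancel-<
    (ℚᵘ.<-respʳ-≃ (ℚᵘ.≃-sym (toℚᵘ-/ (ℚ.⌊ q ⌋ ℤ.+ + 1) 0))
      (ℚᵘ.*<* (begin-strict
        i ℤ.* + 1                               ≡⟨ ℤ.*-identityʳ i ⟩
        i                                       <⟨ ℤ.n<s[n/ℕd]*d i (suc d) ⟩
        ℤ.suc (i ℤ./ℕ suc d) ℤ.* + suc d        ≡⟨ cong (λ j → ℤ.suc j ℤ.* + suc d) (ℤ.div-pos-is-/ℕ i (suc d)) ⟨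
        ℤ.suc ℚ.⌊ q ⌋ ℤ.* + suc d               ≡⟨ cong (ℤ._* + suc d) (ℤ.+-comm (+ 1) ℚ.⌊ q ⌋) ⟩
        (ℚ.⌊ q ⌋ ℤ.+ + 1) ℤ.* + suc d           ∎)))
    where open ℤ.≤-Reasoning

  floor-nonNeg : ∀ q → 0ℚ ℚ.≤ q → + ℤ.∣ ℚ.⌊ q ⌋ ∣ ≡ ℚ.⌊ q ⌋
  floor-nonNeg q@(mkℚ i d _) (ℚ.*≤* 0≤i) = ℤ.0≤i⇒+∣i∣≡i
    (ℤ.0≤n⇒0≤n/d i (+ suc d)
      (subst₂ ℤ._≤_ (ℤ.*-zeroˡ (+ suc d)) (ℤ.*-identityʳ i) 0≤i) (ℤ.+≤+ ℕ.z≤n))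

  ι-pos : ∀ k → ℚ.Positive (ι (+ suc k))
  ι-pos k = ℚ.normalize-pos (suc k) 1

  square-* : ∀ s c → (s ℚ.* s) ℚ.* (c ℚ.* c) ≡ (s ℚ.* c) ℚ.* (s ℚ.* c)
  square-* = solve 2 (λ s c → (s :* s) :* (c :* c) := (s :* c) :* (s :* c)) refl

  0≤/ : ∀ m k → 0ℚ ℚ.≤ + m ℚ./ suc k
  0≤/ m k = ℚ.nonNegative⁻¹ _ {{ℚ.normalize-nonNeg m (suc k)}}

module _ (k : ℕ) (q : ℚ) where

  private
    c y : ℚ
    c = + suc k ℚ./ 1
    y = (q ℚ.⊔ 0ℚ) ℚ.* (c ℚ.* c)

    n r : ℕ
    n = ℤ.∣ ℚ.⌊ y ⌋ ∣
    r = sqrtℕ n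

    instance
      c-pos  = ι-pos k
      cc-pos = ℚ.pos*pos⇒pos c c
      cc-nonNeg = ℚ.pos⇒nonNeg (c ℚ.* c)

    0≤y : 0ℚ ℚ.≤ y
    0≤y = subst (ℚ._≤ y) (ℚ.*-zeroˡ (c ℚ.* c))
      (ℚ.*-monoʳ-≤-nonNeg (c ℚ.* c) (ℚ.p≤q⊔p q 0ℚ))

    ιn : ι (+ n) ≡ ι ℚ.⌊ y ⌋
    ιn = cong ι (floor-nonNeg y 0≤y)

  sqrtℚ-nonNeg : 0ℚ ℚ.≤ sqrtℚ k q
  sqrtℚ-nonNeg = 0≤/ r k

  sqrtℚ-lower : sqrtℚ k q ℚ.* sqrtℚ k q ℚ.≤ q ℚ.⊔ 0ℚ
  sqrtℚ-lower = ℚ.*-cancelʳ-≤-pos (c ℚ.* c) (begin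
    (s ℚ.* s) ℚ.* (c ℚ.* c)  ≡⟨ square-* s c ⟩
    (s ℚ.* c) ℚ.* (s ℚ.* c)  ≡⟨ cong (λ t → t ℚ.* t) (/-*-cancel (+ r) k) ⟩
    ι (+ r) ℚ.* ι (+ r)      ≡⟨ ι-* (+ r) (+ r) ⟨
    ι (+ r ℤ.* + r)          ≡⟨ cong ι (ℤ.pos-* r r) ⟨
    ι (+ (r ℕ.* r))          ≤⟨ ι-mono-≤ (ℤ.+≤+ (sqrtℕ-lower n)) ⟩
    ι (+ n)                  ≡⟨ ιn ⟩
    ι ℚ.⌊ y ⌋                ≤⟨ floor-lower y ⟩
    y                        ∎)
    where
    open ℚ.≤-Reasoning
    s = sqrtℚ k q

  sqrtℚ-upper : let t = sqrtℚ k q ℚ.+ (+ 1 ℚ./ suc k) in q ℚ.⊔ 0ℚ ℚ.< t ℚ.* t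
  sqrtℚ-upper = ℚ.*-cancelʳ-<-nonNeg (c ℚ.* c) (begin-strict
    y                            <⟨ floor-upper y ⟩
    ι (ℚ.⌊ y ⌋ ℤ.+ + 1)          ≡⟨ ι-+ ℚ.⌊ y ⌋ (+ 1) ⟩
    ι ℚ.⌊ y ⌋ ℚ.+ ι (+ 1)        ≡⟨ cong (ℚ._+ ι (+ 1)) ιn ⟨
    ι (+ n) ℚ.+ ι (+ 1)          ≡⟨ ι-+ (+ n) (+ 1) ⟨
    ι (+ n ℤ.+ + 1)              ≡⟨ cong (ι ∘ +_) (ℕ.+-comm n 1) ⟩
    ι (+ suc n)                  ≤⟨ ι-mono-≤ (ℤ.+≤+ (sqrtℕ-upper n)) ⟩
    ι (+ (suc r ℕ.* suc r))      ≡⟨ cong ι (ℤ.pos-* (suc r) (suc r)) ⟩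
    ι (+ suc r ℤ.* + suc r)      ≡⟨ ι-* (+ suc r) (+ suc r) ⟩
    ι (+ suc r) ℚ.* ι (+ suc r)  ≡⟨ cong (λ u → u ℚ.* u) tc ⟨
    (t ℚ.* c) ℚ.* (t ℚ.* c)      ≡⟨ square-* t c ⟨
    (t ℚ.* t) ℚ.* (c ℚ.* c)      ∎)
    where
    open ℚ.≤-Reasoning
    s = sqrtℚ k q
    e = + 1 ℚ./ suc k
    t = s ℚ.+ e
    tc : t ℚ.* c ≡ ι (+ suc r)
    tc = begin-equality
      t ℚ.* c                ≡⟨ ℚ.*-distribʳ-+ c s e ⟩
      s ℚ.* c ℚ.+ e ℚ.* c    ≡⟨ cong₂ ℚ._+_ (/-*-cancel (+ r) k) (/-*-cancel (+ 1) k) ⟩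
      ι (+ r) ℚ.+ ι (+ 1)    ≡⟨ ι-+ (+ r) (+ 1) ⟨
      ι (+ r ℤ.+ + 1)        ≡⟨ cong (ι ∘ +_) (ℕ.+-comm r 1) ⟩
      ι (+ suc r)            ∎

private

  archimedean : ∀ ε → 0ℚ ℚ.< ε → ∃[ N ] (∀ n → N ℕ.≤ n → + 1 ℚ./ suc n ℚ.≤ ε)
  archimedean (mkℚ (+ zero)  d _) (ℚ.*<* (ℤ.+<+ ()))
  archimedean (mkℚ -[1+ _ ]  d _) (ℚ.*<* ())
  archimedean (mkℚ (+ suc p) d _) _ = d , λ n d≤n → ℚ.toℚᵘ-cancel-≤
    (ℚᵘ.≤-respˡ-≃ (ℚᵘ.≃-sym (toℚᵘ-/ (+ 1) n))
      (ℚᵘ.*≤* (ℤ.≤-trans (ℤ.≤-reflexive (ℤ.*-identityˡ (+ suc d)))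
        (ℤ.+≤+ (ℕ.≤-trans (ℕ.s≤s d≤n) (ℕ.m≤n*m (suc n) (suc p)))))))

  ⊔0-close : ∀ p q → p ℚ.⊔ 0ℚ ℚ.≤ q ℚ.⊔ 0ℚ ℚ.+ ℚ.∣ p ℚ.- q ∣
  ⊔0-close p q = ℚ.⊔-lub p≤ 0≤
    where
    open ℚ.≤-Reasoning
    p≤ : p ℚ.≤ q ℚ.⊔ 0ℚ ℚ.+ ℚ.∣ p ℚ.- q ∣
    p≤ = begin
      p                            ≡⟨ solve 2 (λ p q → p := q :+ (p :- q)) refl p q ⟩
      q ℚ.+ (p ℚ.- q)              ≤⟨ ℚ.+-mono-≤ (ℚ.p≤p⊔q q 0ℚ) (p≤∣p∣ (p ℚ.- q)) ⟩
      q ℚ.⊔ 0ℚ ℚ.+ ℚ.∣ p ℚ.- q ∣  ∎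
    0≤ : 0ℚ ℚ.≤ q ℚ.⊔ 0ℚ ℚ.+ ℚ.∣ p ℚ.- q ∣
    0≤ = ℚ.+-mono-≤ (ℚ.p≤q⊔p q 0ℚ) (ℚ.0≤∣p∣ (p ℚ.- q))

  square-mono-≤ : ∀ {p q} → 0ℚ ℚ.≤ p → p ℚ.≤ q → p ℚ.* p ℚ.≤ q ℚ.* q
  square-mono-≤ {p} {q} 0≤p p≤q = ℚ.≤-trans
    (ℚ.*-monoʳ-≤-nonNeg p {{ℚ.nonNegative 0≤p}} p≤q)
    (ℚ.*-monoˡ-≤-nonNeg q {{ℚ.nonNegative (ℚ.≤-trans 0≤p p≤q)}} p≤q)

  squares-close : ∀ s u δ → 0ℚ ℚ.≤ u → 0ℚ ℚ.≤ δ →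
    s ℚ.* s ℚ.< u ℚ.* u ℚ.+ δ ℚ.* δ → s ℚ.< u ℚ.+ δ
  squares-close s u δ 0≤u 0≤δ s²<u²+δ² = ℚ.≰⇒> λ u+δ≤s →
    ℚ.<-irrefl refl (begin-strict
      s ℚ.* s
        <⟨ s²<u²+δ² ⟩
      u ℚ.* u ℚ.+ δ ℚ.* δ
        ≡⟨ ℚ.+-identityʳ (u ℚ.* u ℚ.+ δ ℚ.* δ) ⟨
      u ℚ.* u ℚ.+ δ ℚ.* δ ℚ.+ 0ℚ
        ≤⟨ ℚ.+-monoʳ-≤ (u ℚ.* u ℚ.+ δ ℚ.* δ) 0≤2uδ ⟩
      u ℚ.* u ℚ.+ δ ℚ.* δ ℚ.+ (u ℚ.* δ ℚ.+ u ℚ.* δ)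
        ≡⟨ solve 2 (λ u δ → u :* u :+ δ :* δ :+ (u :* δ :+ u :* δ)
                              := (u :+ δ) :* (u :+ δ)) refl u δ ⟩
      (u ℚ.+ δ) ℚ.* (u ℚ.+ δ)
        ≤⟨ square-mono-≤ (ℚ.+-mono-≤ 0≤u 0≤δ) u+δ≤s ⟩
      s ℚ.* s ∎)
    where
    open ℚ.≤-Reasoning
    0≤uδ : 0ℚ ℚ.≤ u ℚ.* δ
    0≤uδ = subst (ℚ._≤ u ℚ.* δ) (ℚ.*-zeroˡ δ)
      (ℚ.*-monoʳ-≤-nonNeg δ {{ℚ.nonNegative 0≤δ}} 0≤u)
    0≤2uδ : 0ℚ ℚ.≤ u ℚ.* δ ℚ.+ u ℚ.* δ
    0≤2uδ = ℚ.+-mono-≤ 0≤uδ 0≤uδ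

  sqrtℚ-close : ∀ m n p q δ → 0ℚ ℚ.≤ δ → + 1 ℚ./ suc n ℚ.≤ δ →
    ℚ.∣ p ℚ.- q ∣ ℚ.< δ ℚ.* δ → sqrtℚ m p ℚ.< sqrtℚ n q ℚ.+ (δ ℚ.+ δ)
  sqrtℚ-close m n p q δ 0≤δ e≤δ p~q = begin-strict
    s                <⟨ squares-close s (t ℚ.+ e) δ 0≤t+e 0≤δ s²< ⟩
    (t ℚ.+ e) ℚ.+ δ  ≤⟨ ℚ.+-monoˡ-≤ δ (ℚ.+-monoʳ-≤ t e≤δ) ⟩
    (t ℚ.+ δ) ℚ.+ δ  ≡⟨ ℚ.+-assoc t δ δ ⟩
    t ℚ.+ (δ ℚ.+ δ)  ∎
    where
    open ℚ.≤-Reasoning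
    s = sqrtℚ m p
    t = sqrtℚ n q
    e = + 1 ℚ./ suc n
    0≤t+e : 0ℚ ℚ.≤ t ℚ.+ e
    0≤t+e = ℚ.+-mono-≤ (sqrtℚ-nonNeg n q) (0≤/ 1 n)
    s²< : s ℚ.* s ℚ.< (t ℚ.+ e) ℚ.* (t ℚ.+ e) ℚ.+ δ ℚ.* δ
    s²< = begin-strict
      s ℚ.* s                                ≤⟨ sqrtℚ-lower m p ⟩
      p ℚ.⊔ 0ℚ                               ≤⟨ ⊔0-close p q ⟩
      q ℚ.⊔ 0ℚ ℚ.+ ℚ.∣ p ℚ.- q ∣             <⟨ ℚ.+-mono-< (sqrtℚ-upper n q) p~q ⟩
      (t ℚ.+ e) ℚ.* (t ℚ.+ e) ℚ.+ δ ℚ.* δ    ∎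

-- Total square root: √ x is 0 for negative x.
√_ : ℝ → ℝ
√ x = mkℝ (λ n → sqrtℚ n (seq x n)) √-cauchy
  where
  √-cauchy : IsCauchy (λ n → sqrtℚ n (seq x n))
  √-cauchy ε 0<ε =
    let δ        = ½ ℚ.* ε
        0<δ      = ½*-pos 0<ε
        (M , ar) = archimedean δ 0<δ
        (N , cx) = cauchy x (δ ℚ.* δ) (ℚ.positive⁻¹ (δ ℚ.* δ)
                     {{ℚ.pos*pos⇒pos δ {{ℚ.positive 0<δ}} δ {{ℚ.positive 0<δ}}}})
        close : ∀ m n → M ℕ.⊔ N ℕ.≤ m → M ℕ.⊔ N ℕ.≤ n →
                sqrtℚ m (seq x m) ℚ.< sqrtℚ n (seq x n) ℚ.+ ε
        close m n h k = subst (λ d → sqrtℚ m (seq x m) ℚ.< sqrtℚ n (seq x n) ℚ.+ d)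
          (½+½ ε)
          (sqrtℚ-close m n (seq x m) (seq x n) δ (ℚ.<⇒≤ 0<δ)
            (ar n (ℕ.m⊔n≤o⇒m≤o M N k))
            (cx m n (ℕ.m⊔n≤o⇒n≤o M N h) (ℕ.m⊔n≤o⇒n≤o M N k)))
    in M ℕ.⊔ N , λ m n h k →
         ∣p-q∣<ε (sqrtℚ m (seq x m)) (sqrtℚ n (seq x n)) ε (close m n h k) (close n m k h)

infix 8 √_

------------------------------------------------------------------------
-- The plane

Point : Set
Point = ℝ × ℝ

infix 4 _≈_

_≈_ : Point → Point → Set
(x₁ , y₁) ≈ (x₂ , y₂) = x₁ ≃ x₂ × y₁ ≃ y₂

d : Point → Point → ℝ
d (x₁ , y₁) (x₂ , y₂) = √ ((x₁ - x₂) * (x₁ - x₂) + (y₁ - y₂) * (y₁ - y₂))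

-- An unordered pair {a , b}; nothing below depends on the order.
Edge : Set
Edge = Point × Point

edgeLength : Edge → ℝ
edgeLength (a , b) = d a b

-- p ∈L e: the point p lies on the closed segment L(e).
infix 4 _∈L_

_∈L_ : Point → Edge → Set
p ∈L ((a₁ , a₂) , (b₁ , b₂)) = ∃[ t ]
  (0ℝ ≤ t × t ≤ 1ℝ × p ≈ ((1ℝ - t) * a₁ + t * b₁ , (1ℝ - t) * a₂ + t * b₂))

IsEndpoint : Point → Edge → Set
IsEndpoint p (a , b) = p ≈ a ⊎ p ≈ b

------------------------------------------------------------------------
-- Finite point sets and tours

record PointSet (n : ℕ) : Set where
  field
    point    : Vector Point n
    distinct : ∀ {i j} → point i ≈ point j → i ≡ j

open PointSet public

infixl 6 _∖_

_∖_ : ∀ {n} → PointSet (suc n) → Fin (suc n) → PointSet n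
X ∖ x = record
  { point    = removeAt (point X) x
  ; distinct = punchIn-injective x _ _ ∘ distinct X
  }

-- The cyclic successor.
next : ∀ {n} → Fin n → Fin n
next {suc n} i = suc (toℕ i) mod suc n

-- A Hamiltonian cycle visits the points in the cyclic order
-- order 0, order 1, …, order (n - 1); a cycle has at least 3 vertices.
record Tour {n : ℕ} (X : PointSet n) : Set where
  field
    3≤n   : 3 ℕ.≤ n
    order : Permutation′ n

  vertex : Vector Point n
  vertex i = point X (order ⟨$⟩ʳ i)

  edge : Vector Edge n
  edge i = vertex i , vertex (next i)

  length : ℝ
  length = foldr _+_ 0ℝ (edgeLength ∘ edge)

  -- Since the vertices are pairwise distinct, a point that is an endpoint
  -- of both edges is a shared endpoint.
  Noncrossing : Set
  Noncrossing = ∀ i j → i ≢ j → ∀ p → p ∈L edge i → p ∈L edge j →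
    IsEndpoint p (edge i) × IsEndpoint p (edge j)

open Tour public using (length; Noncrossing)

{-# OPTIONS --safe #-}
-- The example is a pinwheel: a hexagon whose vertices alternate between a
-- small triangle around x and three far away points, twisted so that x sees
-- no edge of the hexagon completely.  Hence x cannot be inserted into the
-- hexagon, and every noncrossing tour through all seven points has to be
-- rearranged in a way that loses more length than the visit to x gains.
-- That last claim is finite: all points are rational, so crossings of edges
-- are decidable, lengths are compared through integer bounds, and the tours
-- are searched exhaustively, dropping a partial tour at its first crossing.
module Submission where

open import Defs
open import Data.Bool.Base using (Bool; T)
open import Data.Bool.Properties using (T?)
open import Data.Fin.Base using (Fin; zero; suc)
import Data.Fin.Permutation as Perm
open import Data.Fin.Permutation using (_⟨$⟩ʳ_; _⟨$⟩ˡ_)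
open import Data.Fin.Properties as Fin using (all?)
open import Data.Integer.Base as ℤ using (ℤ; +_)
open import Data.List.Base as List using (List; []; _∷_)
open import Data.List.Membership.Propositional using (_∈_; _∉_)
import Data.List.Membership.DecPropositional as Membership
open import Data.List.Relation.Unary.All using (All; []; _∷_)
import Data.List.Relation.Unary.All as All
import Data.List.Relation.Unary.All.Properties as All
open import Data.List.Relation.Unary.AllPairs using (AllPairs; []; _∷_)
import Data.List.Relation.Unary.AllPairs.Properties as AllPairs
open import Data.List.Relation.Unary.Any using (Any; any?; here; there)
open import Data.List.Relation.Unary.Unique.Propositional using (Unique)
import Data.List.Relation.Unary.Unique.Propositional.Properties as Unique
open import Data.Nat.Base as ℕ using (ℕ; zero; suc)
import Data.Nat.Properties as ℕ
open import Data.Product using (Σ-syntax; ∃-syntax; _×_; _,_; proj₁; proj₂)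
open import Data.Product.Properties using (≡-dec)
open import Data.Rational.Base as ℚ using (ℚ; 0ℚ; 1ℚ)
import Data.Rational.Properties as ℚ
import Data.Rational.Solver as ℚ
open import Data.Rational.Unnormalised.Base as ℚᵘ using (mkℚᵘ)
import Data.Rational.Unnormalised.Properties as ℚᵘ
open import Data.Sum.Base as Sum using (_⊎_; inj₁; inj₂)
open import Data.Vec.Base as Vec using (Vec; []; _∷_)
open import Data.Vec.Functional using (Vector; foldr)
open import Data.Vec.Properties using (lookup∘tabulate)
open import Function.Base using (_∘_)
open import Relation.Binary.PropositionalEquality
  using (_≡_; _≢_; refl; sym; trans; cong; cong₂; subst; module ≡-Reasoning)
open import Relation.Nullary using (¬_; Dec; yes; no; contradiction; isYes; ¬?; from-yes)
open import Relation.Nullary.Decidable using (_×-dec_; _⊎-dec_; _→-dec_; toWitness)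

open ℚ.+-*-Solver using (solve; con; _:+_; _:-_; _:*_; :-_; _:=_)

-- Null sequences

-- `x ≃ y` unfolds to `Null` of the termwise difference, so equations between reals follow by
-- writing one difference as a rational combination of others.
Null : (ℕ → ℚ) → Set
Null f = ∀ ε → 0ℚ ℚ.< ε → ∃[ N ] (∀ n → N ℕ.≤ n → ℚ.∣ f n ∣ ℚ.< ε)

null-cong : ∀ {f g} → (∀ n → f n ≡ g n) → Null f → Null g
null-cong f≡g null ε 0<ε with null ε 0<ε
... | N , h = N , λ n N≤n → subst (λ q → ℚ.∣ q ∣ ℚ.< ε) (f≡g n) (h n N≤n)

null-0 : Null (λ _ → 0ℚ)
null-0 ε 0<ε = 0 , λ _ _ → 0<ε

null-+ : ∀ {f g} → Null f → Null g → Null (λ n → f n ℚ.+ g n)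
null-+ {f} {g} nf ng ε 0<ε with nf (ℚ.½ ℚ.* ε) 0<½ε | ng (ℚ.½ ℚ.* ε) 0<½ε
  where
  0<½ε : 0ℚ ℚ.< ℚ.½ ℚ.* ε
  0<½ε = subst (ℚ._< ℚ.½ ℚ.* ε) (ℚ.*-zeroʳ ℚ.½) (ℚ.*-monoʳ-<-pos ℚ.½ 0<ε)
... | M , hf | N , hg = M ℕ.⊔ N , λ n h → begin-strict
  ℚ.∣ f n ℚ.+ g n ∣                ≤⟨ ℚ.∣p+q∣≤∣p∣+∣q∣ (f n) (g n) ⟩
  ℚ.∣ f n ∣ ℚ.+ ℚ.∣ g n ∣          <⟨ ℚ.+-mono-< (hf n (ℕ.m⊔n≤o⇒m≤o M N h)) (hg n (ℕ.m⊔n≤o⇒n≤o M N h)) ⟩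
  ℚ.½ ℚ.* ε ℚ.+ ℚ.½ ℚ.* ε          ≡⟨ solve 1 (λ ε → con ℚ.½ :* ε :+ con ℚ.½ :* ε := ε) refl ε ⟩
  ε                                ∎
  where open ℚ.≤-Reasoning

null-* : ∀ c {f} → Null f → Null (λ n → c ℚ.* f n)
null-* c {f} nf ε 0<ε = proj₁ (nf δ 0<δ) , λ n h → begin-strict
  ℚ.∣ c ℚ.* f n ∣          ≡⟨ ℚ.∣p*q∣≡∣p∣*∣q∣ c (f n) ⟩
  ℚ.∣ c ∣ ℚ.* ℚ.∣ f n ∣    ≤⟨ ℚ.*-monoʳ-≤-nonNeg ℚ.∣ f n ∣ {{ℚ.∣-∣-nonNeg (f n)}} ∣c∣≤B ⟩
  B ℚ.* ℚ.∣ f n ∣          <⟨ ℚ.*-monoʳ-<-pos B (proj₂ (nf δ 0<δ) n h) ⟩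
  B ℚ.* (ℚ.1/ B ℚ.* ε)     ≡⟨ ℚ.*-assoc B (ℚ.1/ B) ε ⟨
  B ℚ.* ℚ.1/ B ℚ.* ε       ≡⟨ cong (ℚ._* ε) (ℚ.*-inverseʳ B) ⟩
  1ℚ ℚ.* ε                 ≡⟨ ℚ.*-identityˡ ε ⟩
  ε                        ∎
  where
  open ℚ.≤-Reasoning
  -- Adding 1 keeps `B` invertible when `c` is 0.
  B = ℚ.∣ c ∣ ℚ.+ 1ℚ
  ∣c∣≤B : ℚ.∣ c ∣ ℚ.≤ B
  ∣c∣≤B = subst (ℚ._≤ B) (ℚ.+-identityʳ ℚ.∣ c ∣) (ℚ.+-monoʳ-≤ ℚ.∣ c ∣ (ℚ.nonNegative⁻¹ 1ℚ))
  instance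
    B-pos = ℚ.positive (ℚ.+-mono-≤-< (ℚ.0≤∣p∣ c) (ℚ.positive⁻¹ 1ℚ))
    B-nonZero = ℚ.pos⇒nonZero B
    1/B-pos = ℚ.1/pos⇒pos B
    ε-pos = ℚ.positive 0<ε
  δ = ℚ.1/ B ℚ.* ε
  0<δ = ℚ.positive⁻¹ δ {{ℚ.pos*pos⇒pos (ℚ.1/ B) ε}}

-- Equality and order of reals that equal rationals.

<⇒≱ : ∀ {p q} → p ℚ.< q → ¬ (q ℚ.≤ p)
<⇒≱ p<q q≤p = ℚ.<-irrefl refl (ℚ.<-≤-trans p<q q≤p)

∣p-q∣<r⇒p<q+r : ∀ p q r → ℚ.∣ p ℚ.- q ∣ ℚ.< r → p ℚ.< q ℚ.+ r
∣p-q∣<r⇒p<q+r p q r h = begin-strict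
  p                          ≡⟨ solve 2 (λ p q → p := q :+ (p :- q)) refl p q ⟩
  q ℚ.+ (p ℚ.- q)            ≤⟨ ℚ.+-monoʳ-≤ q p-q≤ ⟩
  q ℚ.+ ℚ.∣ p ℚ.- q ∣        <⟨ ℚ.+-monoʳ-< q h ⟩
  q ℚ.+ r                    ∎
  where
  open ℚ.≤-Reasoning
  p-q≤ : p ℚ.- q ℚ.≤ ℚ.∣ p ℚ.- q ∣
  p-q≤ with ℚ.≤-total 0ℚ (p ℚ.- q)
  ... | inj₁ 0≤ = ℚ.≤-reflexive (sym (ℚ.0≤p⇒∣p∣≡p 0≤))
  ... | inj₂ ≤0 = ℚ.≤-trans ≤0 (ℚ.0≤∣p∣ (p ℚ.- q))

≃-refl : ∀ x → x ≃ x
≃-refl x = null-cong (λ n → sym (ℚ.+-inverseʳ (seq x n))) null-0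

≃-sym : ∀ x y → x ≃ y → y ≃ x
≃-sym x y x≃y = null-cong
  (λ n → solve 2 (λ a b → con (ℚ.- 1ℚ) :* (a :- b) := b :- a) refl (seq x n) (seq y n))
  (null-* (ℚ.- 1ℚ) x≃y)

-- If `q < p`, let `ε` be a third of the gap. Eventually `seq y n` is below `q + ε` and `seq x n`
-- above `p - ε`; these bounds are `ε` apart, so `ε` witnesses `y < x`, which `x ≤ y` denies.
≤-fromℚ⁻ : ∀ x y p q → x ≃ fromℚ p → y ≃ fromℚ q → x ≤ y → p ℚ.≤ q
≤-fromℚ⁻ x y p q x≃p y≃q x≤y = ℚ.≮⇒≥ λ q<p →
  let ε = ⅓ ℚ.* (p ℚ.- q)
      0<ε = subst (ℚ._< ε) (ℚ.*-zeroʳ ⅓) (ℚ.*-monoʳ-<-pos ⅓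
              (subst (ℚ._< p ℚ.- q) (ℚ.+-inverseʳ q) (ℚ.+-monoˡ-< (ℚ.- q) q<p)))
      (M , hx) = ≃-sym x (fromℚ p) x≃p ε 0<ε
      (N , hy) = y≃q ε 0<ε
  in x≤y (ε , 0<ε , M ℕ.⊔ N , λ n h → ℚ.<⇒≤ (begin-strict
    seq y n ℚ.+ ε
      <⟨ ℚ.+-monoˡ-< ε (∣p-q∣<r⇒p<q+r (seq y n) q ε (hy n (ℕ.m⊔n≤o⇒n≤o M N h))) ⟩
    q ℚ.+ ε ℚ.+ ε
      ≡⟨ solve 2 (λ p q → q :+ con ⅓ :* (p :- q) :+ con ⅓ :* (p :- q)
                            := p :- con ⅓ :* (p :- q)) refl p q ⟩
    p ℚ.- ε
      <⟨ ℚ.+-monoˡ-< (ℚ.- ε) (∣p-q∣<r⇒p<q+r p (seq x n) ε (hx n (ℕ.m⊔n≤o⇒m≤o M N h))) ⟩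
    seq x n ℚ.+ ε ℚ.- ε
      ≡⟨ solve 2 (λ a ε → a :+ ε :- ε := a) refl (seq x n) ε ⟩
    seq x n ∎))
  where
  open ℚ.≤-Reasoning
  ⅓ = + 1 ℚ./ 3

≤-refl : ∀ x → x ≤ x
≤-refl x (ε , 0<ε , N , h) = <⇒≱ (ℚ.+-monoʳ-< (seq x N) 0<ε)
  (subst (seq x N ℚ.+ ε ℚ.≤_) (sym (ℚ.+-identityʳ (seq x N))) (h N ℕ.≤-refl))

fromℚ-mono-≤ : ∀ {p q} → p ℚ.≤ q → fromℚ p ≤ fromℚ q
fromℚ-mono-≤ {p} {q} p≤q (ε , 0<ε , N , h) =
  <⇒≱ (ℚ.+-mono-≤-< p≤q 0<ε) (subst (q ℚ.+ ε ℚ.≤_) (sym (ℚ.+-identityʳ p)) (h N ℕ.≤-refl))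

-- The real `fromℚ p` has both `p` and `q` as its value; comparing it with itself under the two
-- readings gives both inequalities.
fromℚ-injective : ∀ p q → fromℚ p ≃ fromℚ q → p ≡ q
fromℚ-injective p q p≃q = ℚ.≤-antisym
  (≤-fromℚ⁻ (fromℚ p) (fromℚ p) p q (≃-refl (fromℚ p)) p≃q (≤-refl (fromℚ p)))
  (≤-fromℚ⁻ (fromℚ p) (fromℚ p) q p p≃q (≃-refl (fromℚ p)) (≤-refl (fromℚ p)))

-- Rational segments

ℚ² Segment : Set
ℚ² = ℚ × ℚ
Segment = ℚ² × ℚ²

embed : ℚ² → Point
embed (x , y) = fromℚ x , fromℚ y

embedˢ : Segment → Edge
embedˢ (a , b) = embed a , embed b

infixl 6 _⊖_

_⊖_ : ℚ² → ℚ² → ℚ²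
(x₁ , y₁) ⊖ (x₂ , y₂) = x₁ ℚ.- x₂ , y₁ ℚ.- y₂

det : ℚ² → ℚ² → ℚ
det (x₁ , y₁) (x₂ , y₂) = x₁ ℚ.* y₂ ℚ.- y₁ ℚ.* x₂

-- The cross product of the direction vectors; for nondegenerate segments it vanishes exactly when
-- they are parallel.
slant : Segment → Segment → ℚ
slant (a , b) (c , d) = det (b ⊖ a) (d ⊖ c)

-- Made total, with value 0 at 0, so that `param` and the decision procedures carry no proof of
-- nonvanishing.
recip : ℚ → ℚ
recip q with q ℚ.≟ 0ℚ
... | yes _ = 0ℚ
... | no q≢0 = ℚ.1/_ q {{ℚ.≢-nonZero q≢0}}

*-recip : ∀ {q} → q ≢ 0ℚ → q ℚ.* recip q ≡ 1ℚ
*-recip {q} q≢0 with q ℚ.≟ 0ℚ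
... | yes q≡0 = contradiction q≡0 q≢0
... | no q≢0′ = ℚ.*-inverseʳ q {{ℚ.≢-nonZero q≢0′}}

at : Segment → ℚ → ℚ²
at ((a₁ , a₂) , (b₁ , b₂)) t =
  (1ℚ ℚ.- t) ℚ.* a₁ ℚ.+ t ℚ.* b₁ , (1ℚ ℚ.- t) ℚ.* a₂ ℚ.+ t ℚ.* b₂

-- By Cramer's rule the lines through e and f meet in at e (param e f); the
-- value is junk if they are parallel.
param : Segment → Segment → ℚ
param e@(a , b) f@(c , d) = det (d ⊖ c) (a ⊖ c) ℚ.* recip (slant e f)

meet : Segment → Segment → ℚ²
meet e f = at e (param e f)

UnitInterval : ℚ → Set
UnitInterval t = 0ℚ ℚ.≤ t × t ℚ.≤ 1ℚ

Endpoint : ℚ² → Segment → Set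
Endpoint p (a , b) = p ≡ a ⊎ p ≡ b

EndpointOfBoth : Segment → Segment → Set
EndpointOfBoth e f = Endpoint (meet e f) e × Endpoint (meet e f) f

-- Only transversal meetings count, not collinear overlaps. In the search this is safe, since it can
-- only discard fewer tours; for the pinwheel, parallel edges are ruled out separately.
Intersect : Segment → Segment → Set
Intersect e f = slant e f ≢ 0ℚ × UnitInterval (param e f) × UnitInterval (param f e)

Crosses : Segment → Segment → Set
Crosses e f = Intersect e f × ¬ EndpointOfBoth e f

unitInterval? : ∀ t → Dec (UnitInterval t)
unitInterval? t = 0ℚ ℚ.≤? t ×-dec t ℚ.≤? 1ℚ

endpoint? : ∀ p e → Dec (Endpoint p e)
endpoint? p (a , b) = ≡-dec ℚ._≟_ ℚ._≟_ p a ⊎-dec ≡-dec ℚ._≟_ ℚ._≟_ p b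

endpointOfBoth? : ∀ e f → Dec (EndpointOfBoth e f)
endpointOfBoth? e f = endpoint? (meet e f) e ×-dec endpoint? (meet e f) f

intersect? : ∀ e f → Dec (Intersect e f)
intersect? e f = ¬? (slant e f ℚ.≟ 0ℚ) ×-dec unitInterval? (param e f) ×-dec unitInterval? (param f e)

crosses? : ∀ e f → Dec (Crosses e f)
crosses? e f = intersect? e f ×-dec ¬? (endpointOfBoth? e f)

slant-flip : ∀ e f → slant f e ≡ ℚ.- slant e f
slant-flip ((a₁ , a₂) , (b₁ , b₂)) ((c₁ , c₂) , (d₁ , d₂)) =
  solve 4 (λ u v x y → x :* v :- y :* u := :- (u :* y :- v :* x)) refl
    (b₁ ℚ.- a₁) (b₂ ℚ.- a₂) (d₁ ℚ.- c₁) (d₂ ℚ.- c₂)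

slant-flip-≢0 : ∀ e f → slant e f ≢ 0ℚ → slant f e ≢ 0ℚ
slant-flip-≢0 e f ≢0 ≡0 = ≢0 (trans (slant-flip f e) (cong ℚ.-_ ≡0))

recip-flip : ∀ e f → slant e f ≢ 0ℚ → recip (slant f e) ≡ ℚ.- recip (slant e f)
recip-flip e f ≢0 = begin
  r′                       ≡⟨ ℚ.*-identityˡ r′ ⟨
  1ℚ ℚ.* r′                ≡⟨ cong (ℚ._* r′) (*-recip ≢0) ⟨
  D ℚ.* r ℚ.* r′           ≡⟨ solve 3 (λ D r r′ → D :* r :* r′ := :- r :* (:- D :* r′)) refl D r r′ ⟩
  ℚ.- r ℚ.* (ℚ.- D ℚ.* r′) ≡⟨ cong (λ D′ → ℚ.- r ℚ.* (D′ ℚ.* r′)) (slant-flip e f) ⟨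
  ℚ.- r ℚ.* (slant f e ℚ.* r′) ≡⟨ cong (ℚ.- r ℚ.*_) (*-recip (slant-flip-≢0 e f ≢0)) ⟩
  ℚ.- r ℚ.* 1ℚ             ≡⟨ ℚ.*-identityʳ (ℚ.- r) ⟩
  ℚ.- r                    ∎
  where
  open ≡-Reasoning
  D = slant e f
  r = recip D
  r′ = recip (slant f e)

-- The ring solver does not know that `D * r` is 1, so `r` is a free variable for it: the two sides
-- then differ by a multiple of `1 - D * r`, which `drop` removes.
meet-comm : ∀ e f → slant e f ≢ 0ℚ → meet e f ≡ meet f e
meet-comm e@((a₁ , a₂) , (b₁ , b₂)) f@((c₁ , c₂) , (d₁ , d₂)) ≢0 = begin
  at e (γ ℚ.* r)         ≡⟨ cong₂ _,_ eq₁ eq₂ ⟩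
  at f (α ℚ.* (ℚ.- r))   ≡⟨ cong (λ s → at f (α ℚ.* s)) (recip-flip e f ≢0) ⟨
  meet f e               ∎
  where
  open ≡-Reasoning
  D = slant e f
  r = recip D
  γ = det ((d₁ , d₂) ⊖ (c₁ , c₂)) ((a₁ , a₂) ⊖ (c₁ , c₂))
  α = det ((b₁ , b₂) ⊖ (a₁ , a₂)) ((c₁ , c₂) ⊖ (a₁ , a₂))
  drop : ∀ p k → p ℚ.+ k ℚ.* (1ℚ ℚ.- D ℚ.* r) ≡ p
  drop p k = trans (cong (λ q → p ℚ.+ k ℚ.* (1ℚ ℚ.- q)) (*-recip ≢0))
    (solve 2 (λ p k → p :+ k :* (con 1ℚ :- con 1ℚ) := p) refl p k)
  eq₁ : (1ℚ ℚ.- γ ℚ.* r) ℚ.* a₁ ℚ.+ γ ℚ.* r ℚ.* b₁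
      ≡ (1ℚ ℚ.- α ℚ.* (ℚ.- r)) ℚ.* c₁ ℚ.+ α ℚ.* (ℚ.- r) ℚ.* d₁
  eq₁ = trans (solve 9 (λ a₁ a₂ b₁ b₂ c₁ c₂ d₁ d₂ r →
      let D = (b₁ :- a₁) :* (d₂ :- c₂) :- (b₂ :- a₂) :* (d₁ :- c₁)
          γ = (d₁ :- c₁) :* (a₂ :- c₂) :- (d₂ :- c₂) :* (a₁ :- c₁)
          α = (b₁ :- a₁) :* (c₂ :- a₂) :- (b₂ :- a₂) :* (c₁ :- a₁)
      in (con 1ℚ :- γ :* r) :* a₁ :+ γ :* r :* b₁ :=
        (con 1ℚ :- α :* (:- r)) :* c₁ :+ α :* (:- r) :* d₁ :+ (a₁ :- c₁) :* (con 1ℚ :- D :* r))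
      refl a₁ a₂ b₁ b₂ c₁ c₂ d₁ d₂ r)
    (drop _ (a₁ ℚ.- c₁))
  eq₂ : (1ℚ ℚ.- γ ℚ.* r) ℚ.* a₂ ℚ.+ γ ℚ.* r ℚ.* b₂
      ≡ (1ℚ ℚ.- α ℚ.* (ℚ.- r)) ℚ.* c₂ ℚ.+ α ℚ.* (ℚ.- r) ℚ.* d₂
  eq₂ = trans (solve 9 (λ a₁ a₂ b₁ b₂ c₁ c₂ d₁ d₂ r →
      let D = (b₁ :- a₁) :* (d₂ :- c₂) :- (b₂ :- a₂) :* (d₁ :- c₁)
          γ = (d₁ :- c₁) :* (a₂ :- c₂) :- (d₂ :- c₂) :* (a₁ :- c₁)
          α = (b₁ :- a₁) :* (c₂ :- a₂) :- (b₂ :- a₂) :* (c₁ :- a₁)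
      in (con 1ℚ :- γ :* r) :* a₂ :+ γ :* r :* b₂ :=
        (con 1ℚ :- α :* (:- r)) :* c₂ :+ α :* (:- r) :* d₂ :+ (a₂ :- c₂) :* (con 1ℚ :- D :* r))
      refl a₁ a₂ b₁ b₂ c₁ c₂ d₁ d₂ r)
    (drop _ (a₂ ℚ.- c₂))

module _ (e f : Segment) (nonparallel : slant e f ≢ 0ℚ) where

  private
    a₁ = proj₁ (proj₁ e)
    a₂ = proj₂ (proj₁ e)
    b₁ = proj₁ (proj₂ e)
    b₂ = proj₂ (proj₂ e)
    c₁ = proj₁ (proj₁ f)
    c₂ = proj₂ (proj₁ f)
    d₁ = proj₁ (proj₂ f)
    d₂ = proj₂ (proj₂ f)
    D = slant e f
    r = recip D
    γ = det (proj₂ f ⊖ proj₁ f) (proj₁ e ⊖ proj₁ f)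

  -- Subtracting the equations of p on e and on f eliminates p, and taking the
  -- determinant with the direction of f eliminates s.
  parameter-≃ : ∀ p ((t , _) : p ∈L embedˢ e) → p ∈L embedˢ f → t ≃ fromℚ (param e f)
  parameter-≃ (x , y) (t , _ , _ , e₁ , e₂) (s , _ , _ , f₁ , f₂) =
    null-cong (λ n → eq (seq t n) (seq s n))
      (null-* r (null-+
        (null-* w₂ (null-cong (λ n → gap (seq t n) (seq s n) (seq x n) a₁ b₁ c₁ d₁)
          (null-+ f₁ (null-* (ℚ.- 1ℚ) e₁))))
        (null-* (ℚ.- w₁) (null-cong (λ n → gap (seq t n) (seq s n) (seq y n) a₂ b₂ c₂ d₂)
          (null-+ f₂ (null-* (ℚ.- 1ℚ) e₂))))))
    where
    open ≡-Reasoning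
    q₁ = a₁ ℚ.- c₁
    q₂ = a₂ ℚ.- c₂
    v₁ = b₁ ℚ.- a₁
    v₂ = b₂ ℚ.- a₂
    w₁ = d₁ ℚ.- c₁
    w₂ = d₂ ℚ.- c₂
    gap : ∀ t s x a b c d →
      (x ℚ.- ((1ℚ ℚ.- s) ℚ.* c ℚ.+ s ℚ.* d)) ℚ.+ ℚ.- 1ℚ ℚ.* (x ℚ.- ((1ℚ ℚ.- t) ℚ.* a ℚ.+ t ℚ.* b))
      ≡ (a ℚ.- c) ℚ.+ t ℚ.* (b ℚ.- a) ℚ.- s ℚ.* (d ℚ.- c)
    gap = solve 7 (λ t s x a b c d →
      (x :- ((con 1ℚ :- s) :* c :+ s :* d)) :+ con (ℚ.- 1ℚ) :* (x :- ((con 1ℚ :- t) :* a :+ t :* b))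
      := (a :- c) :+ t :* (b :- a) :- s :* (d :- c)) refl
    eq : ∀ t s → r ℚ.* (w₂ ℚ.* (q₁ ℚ.+ t ℚ.* v₁ ℚ.- s ℚ.* w₁) ℚ.+
        ℚ.- w₁ ℚ.* (q₂ ℚ.+ t ℚ.* v₂ ℚ.- s ℚ.* w₂)) ≡ t ℚ.- param e f
    eq t s = begin
      _
        ≡⟨ cong (r ℚ.*_) (solve 8 (λ t s q₁ q₂ v₁ v₂ w₁ w₂ →
             w₂ :* (q₁ :+ t :* v₁ :- s :* w₁) :+ :- w₁ :* (q₂ :+ t :* v₂ :- s :* w₂)
             := t :* (v₁ :* w₂ :- v₂ :* w₁) :- (w₁ :* q₂ :- w₂ :* q₁))
             refl t s q₁ q₂ v₁ v₂ w₁ w₂) ⟩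
      r ℚ.* (t ℚ.* D ℚ.- γ)
        ≡⟨ solve 4 (λ r γ t D → r :* (t :* D :- γ) := t :* (D :* r) :- γ :* r) refl r γ t D ⟩
      t ℚ.* (D ℚ.* r) ℚ.- γ ℚ.* r
        ≡⟨ cong (λ q → t ℚ.* q ℚ.- γ ℚ.* r) (*-recip nonparallel) ⟩
      t ℚ.* 1ℚ ℚ.- γ ℚ.* r
        ≡⟨ cong (ℚ._- γ ℚ.* r) (ℚ.*-identityʳ t) ⟩
      t ℚ.- γ ℚ.* r ∎

  -- A point of `e` is affine in its parameter with slope `b - a`, so replacing `t` by `param e f`
  -- changes each coordinate by a null sequence.
  common-point-≈ : ∀ p → p ∈L embedˢ e → p ∈L embedˢ f → p ≈ embed (meet e f)
  common-point-≈ (x , y) p∈e@(t , _ , _ , e₁ , e₂) p∈f =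
      null-cong (λ n → eq (seq t n) τ (seq x n) a₁ b₁) (null-+ e₁ (null-* (b₁ ℚ.- a₁) t≃τ))
    , null-cong (λ n → eq (seq t n) τ (seq y n) a₂ b₂) (null-+ e₂ (null-* (b₂ ℚ.- a₂) t≃τ))
    where
    τ = param e f
    t≃τ = parameter-≃ (x , y) p∈e p∈f
    eq : ∀ t τ x a b →
      (x ℚ.- ((1ℚ ℚ.- t) ℚ.* a ℚ.+ t ℚ.* b)) ℚ.+ (b ℚ.- a) ℚ.* (t ℚ.- τ)
      ≡ x ℚ.- ((1ℚ ℚ.- τ) ℚ.* a ℚ.+ τ ℚ.* b)
    eq = solve 5 (λ t τ x a b →
      (x :- ((con 1ℚ :- t) :* a :+ t :* b)) :+ (b :- a) :* (t :- τ)
      := x :- ((con 1ℚ :- τ) :* a :+ τ :* b)) refl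

  common-point⇒unitInterval : ∀ p → p ∈L embedˢ e → p ∈L embedˢ f → UnitInterval (param e f)
  common-point⇒unitInterval p p∈e@(t , 0≤t , t≤1 , _) p∈f =
      ≤-fromℚ⁻ 0ℝ t 0ℚ (param e f) (≃-refl 0ℝ) t≃τ 0≤t
    , ≤-fromℚ⁻ t 1ℝ (param e f) 1ℚ t≃τ (≃-refl 1ℝ) t≤1
    where t≃τ = parameter-≃ p p∈e p∈f

at-∈L : ∀ e {t} → UnitInterval t → embed (at e t) ∈L embedˢ e
at-∈L e {t} (0≤t , t≤1) = fromℚ t , fromℚ-mono-≤ 0≤t , fromℚ-mono-≤ t≤1
  , ≃-refl (fromℚ (proj₁ (at e t))) , ≃-refl (fromℚ (proj₂ (at e t)))

embed-injective : ∀ p q → embed p ≈ embed q → p ≡ q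
embed-injective (p₁ , p₂) (q₁ , q₂) (x≃ , y≃) =
  cong₂ _,_ (fromℚ-injective p₁ q₁ x≃) (fromℚ-injective p₂ q₂ y≃)

isEndpoint⁺ : ∀ p q e → p ≈ embed q → Endpoint q e → IsEndpoint p (embedˢ e)
isEndpoint⁺ p q e p≈q (inj₁ refl) = inj₁ p≈q
isEndpoint⁺ p q e p≈q (inj₂ refl) = inj₂ p≈q

isEndpoint⁻ : ∀ q e → IsEndpoint (embed q) (embedˢ e) → Endpoint q e
isEndpoint⁻ q (a , b) = Sum.map (embed-injective q a) (embed-injective q b)

-- Real noncrossing decided by rational crossings.

NoncrossingPair : Edge → Edge → Set
NoncrossingPair e f = ∀ p → p ∈L e → p ∈L f → IsEndpoint p e × IsEndpoint p f

-- `meet e f` lies on `e` by construction and on `f` by `meet-comm`. Noncrossing would make it an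
-- endpoint of both in the real plane, and injectivity of `embed` carries this back to the
-- rationals.
crosses⇒¬noncrossing : ∀ e f → Crosses e f → ¬ NoncrossingPair (embedˢ e) (embedˢ f)
crosses⇒¬noncrossing e f ((nonparallel , ∈e , ∈f) , ¬shared) noncrossing =
  let m = meet e f
      m∈f = subst (λ p → embed p ∈L embedˢ f) (sym (meet-comm e f nonparallel)) (at-∈L f ∈f)
      end-e , end-f = noncrossing (embed m) (at-∈L e ∈e) m∈f
  in ¬shared (isEndpoint⁻ m e end-e , isEndpoint⁻ m f end-f)

-- Nonparallel segments can share only the point `meet e f`. Either it is an endpoint of both, or a
-- common point forces both parameters into the unit interval and so yields a crossing.
¬crosses⇒noncrossing : ∀ e f → slant e f ≢ 0ℚ → ¬ Crosses e f →
  NoncrossingPair (embedˢ e) (embedˢ f)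
¬crosses⇒noncrossing e f nonparallel ¬crosses p p∈e p∈f with endpointOfBoth? e f
... | yes (end-e , end-f) =
      isEndpoint⁺ p (meet e f) e p≈m end-e , isEndpoint⁺ p (meet e f) f p≈m end-f
  where p≈m = common-point-≈ e f nonparallel p p∈e p∈f
... | no ¬shared = contradiction ((nonparallel , ∈e , ∈f) , ¬shared) ¬crosses
  where
  ∈e = common-point⇒unitInterval e f nonparallel p p∈e p∈f
  ∈f = common-point⇒unitInterval f e (slant-flip-≢0 e f nonparallel) p p∈f p∈e

-- Bounds on lengths

dist² : ℚ² → ℚ² → ℚ
dist² (x₁ , y₁) (x₂ , y₂) = (x₁ ℚ.- x₂) ℚ.* (x₁ ℚ.- x₂) ℚ.+ (y₁ ℚ.- y₂) ℚ.* (y₁ ℚ.- y₂)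

square-cancel-≤ : ∀ {p q} → 0ℚ ℚ.≤ q → p ℚ.* p ℚ.≤ q ℚ.* q → p ℚ.≤ q
square-cancel-≤ {p} {q} 0≤q p²≤q² = ℚ.≮⇒≥ λ q<p → <⇒≱ (begin-strict
    q ℚ.* q  ≤⟨ ℚ.*-monoˡ-≤-nonNeg q {{ℚ.nonNegative 0≤q}} (ℚ.<⇒≤ q<p) ⟩
    q ℚ.* p  <⟨ ℚ.*-monoˡ-<-pos p {{ℚ.positive (ℚ.≤-<-trans 0≤q q<p)}} q<p ⟩
    p ℚ.* p  ∎) p²≤q²
  where open ℚ.≤-Reasoning

-- `sqrtℚ k` never overshoots the root, so the bound holds at every index `k` and lengths can be
-- compared term by term.
sqrtℚ-≤ : ∀ k {q u} → 0ℚ ℚ.≤ u → q ℚ.≤ u ℚ.* u → sqrtℚ k q ℚ.≤ u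
sqrtℚ-≤ k {q} {u} 0≤u q≤u² = square-cancel-≤ 0≤u
  (ℚ.≤-trans (sqrtℚ-lower k q) (ℚ.⊔-lub q≤u² 0≤u²))
  where
  0≤u² : 0ℚ ℚ.≤ u ℚ.* u
  0≤u² = subst (ℚ._≤ u ℚ.* u) (ℚ.*-zeroˡ u) (ℚ.*-monoʳ-≤-nonNeg u {{ℚ.nonNegative 0≤u}} 0≤u)

1/≤1 : ∀ k → + 1 ℚ./ suc k ℚ.≤ 1ℚ
1/≤1 k = ℚ.toℚᵘ-cancel-≤ (ℚᵘ.≤-respˡ-≃ (ℚᵘ.≃-sym (ℚ.toℚᵘ-fromℚᵘ (mkℚᵘ (+ 1) k)))
  (ℚᵘ.*≤* (ℤ.+≤+ (ℕ.s≤s ℕ.z≤n))))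

-- sqrtℚ k rounds down by at most 1/(k+1) ≤ 1.
≤-sqrtℚ : ∀ k {q l} → (l ℚ.+ 1ℚ) ℚ.* (l ℚ.+ 1ℚ) ℚ.≤ q → l ℚ.≤ sqrtℚ k q
≤-sqrtℚ k {q} {l} [l+1]²≤q = begin
  l                       ≡⟨ solve 1 (λ l → l := l :+ con 1ℚ :- con 1ℚ) refl l ⟩
  l ℚ.+ 1ℚ ℚ.- 1ℚ         ≤⟨ ℚ.+-monoˡ-≤ (ℚ.- 1ℚ) (ℚ.≤-trans l+1≤t (ℚ.+-monoʳ-≤ s (1/≤1 k))) ⟩
  s ℚ.+ 1ℚ ℚ.- 1ℚ         ≡⟨ solve 1 (λ s → s :+ con 1ℚ :- con 1ℚ := s) refl s ⟩
  s                       ∎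
  where
  open ℚ.≤-Reasoning
  s = sqrtℚ k q
  t = s ℚ.+ (+ 1 ℚ./ suc k)
  l+1≤t : l ℚ.+ 1ℚ ℚ.≤ t
  l+1≤t = square-cancel-≤
    (ℚ.+-mono-≤ (sqrtℚ-nonNeg k q) (ℚ.nonNegative⁻¹ _ {{ℚ.normalize-nonNeg 1 (suc k)}}))
    (ℚ.≤-trans [l+1]²≤q (ℚ.≤-trans (ℚ.p≤p⊔q q 0ℚ) (ℚ.<⇒≤ (sqrtℚ-upper k q))))

sum-≤ : ∀ {n} k (x : Vector ℝ n) (u : Vector ℚ n) → (∀ i → seq (x i) k ℚ.≤ u i) →
  seq (foldr _+_ 0ℝ x) k ℚ.≤ foldr ℚ._+_ 0ℚ u
sum-≤ {zero}  k x u x≤u = ℚ.≤-refl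
sum-≤ {suc n} k x u x≤u = ℚ.+-mono-≤ (x≤u zero) (sum-≤ k (x ∘ suc) (u ∘ suc) (x≤u ∘ suc))

≤-sum : ∀ {n} k (x : Vector ℝ n) (l : Vector ℚ n) → (∀ i → l i ℚ.≤ seq (x i) k) →
  foldr ℚ._+_ 0ℚ l ℚ.≤ seq (foldr _+_ 0ℝ x) k
≤-sum {zero}  k x l l≤x = ℚ.≤-refl
≤-sum {suc n} k x l l≤x = ℚ.+-mono-≤ (l≤x zero) (≤-sum k (x ∘ suc) (l ∘ suc) (l≤x ∘ suc))

-- Exhaustive search for tours

Link : ℕ → Set
Link n = Fin n × Fin n

CrossingTable : ℕ → Set
CrossingTable n = Vec (Vec (Vec (Vec Bool n) n) n) n

query : ∀ {n} → CrossingTable n → Link n → Link n → Bool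
query table (a , b) (c , d) =
  Vec.lookup (Vec.lookup (Vec.lookup (Vec.lookup table a) b) c) d

tabulateLinks : ∀ {n} → (Link n → Link n → Bool) → CrossingTable n
tabulateLinks f = Vec.tabulate λ a → Vec.tabulate λ b → Vec.tabulate λ c → Vec.tabulate λ d →
  f (a , b) (c , d)

query-tabulateLinks : ∀ {n} f (e e′ : Link n) → query (tabulateLinks f) e e′ ≡ f e e′
query-tabulateLinks f (a , b) (c , d) = begin
  query (tabulateLinks f) (a , b) (c , d)
    ≡⟨ cong (λ v → Vec.lookup (Vec.lookup (Vec.lookup v b) c) d) (lookup∘tabulate _ a) ⟩
  Vec.lookup (Vec.lookup (Vec.lookup (Vec.tabulate _) b) c) d
    ≡⟨ cong (λ v → Vec.lookup (Vec.lookup v c) d) (lookup∘tabulate _ b) ⟩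
  Vec.lookup (Vec.lookup (Vec.tabulate _) c) d
    ≡⟨ cong (λ v → Vec.lookup v d) (lookup∘tabulate _ c) ⟩
  Vec.lookup (Vec.tabulate _) d
    ≡⟨ lookup∘tabulate _ d ⟩
  f (a , b) (c , d) ∎
  where open ≡-Reasoning

-- The table is a parameter so that evaluation of the search shares its entries.
module Search {n} (table : CrossingTable n) (weight : Link n → ℚ) where

  open Membership (Fin._≟_ {n}) using (_∈?_)

  Crossing : Link n → Link n → Set
  Crossing e f = T (query table e f)

  crossing? : ∀ e f → Dec (Crossing e f)
  crossing? e f = T? (query table e f)

  links : Fin n → Fin n → List (Fin n) → List (Link n)
  links s u []       = (u , s) ∷ []
  links s u (v ∷ vs) = (u , v) ∷ links s v vs

  total : List (Link n) → ℚ
  total = List.foldr (λ e → weight e ℚ.+_) 0ℚ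

  -- b is the budget left for the rest of the tour.
  Bounded : ℕ → Fin n → Fin n → List (Fin n) → List (Link n) → ℚ → Set
  Bounded zero    s u visited used b = Any (Crossing (u , s)) used ⊎ weight (u , s) ℚ.≤ b
  Bounded (suc k) s u visited used b = ∀ v → v ∈ visited ⊎ Any (Crossing (u , v)) used ⊎
    Bounded k s v (v ∷ visited) ((u , v) ∷ used) (b ℚ.- weight (u , v))

  bounded? : ∀ k s u visited used b → Dec (Bounded k s u visited used b)
  bounded? zero    s u visited used b =
    any? (crossing? (u , s)) used ⊎-dec weight (u , s) ℚ.≤? b
  bounded? (suc k) s u visited used b = all? λ v →
    v ∈? visited ⊎-dec any? (crossing? (u , v)) used ⊎-dec
    bounded? k s v (v ∷ visited) ((u , v) ∷ used) (b ℚ.- weight (u , v))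

  -- Induction along the tour. Of the alternatives in `Bounded`, repetition and crossing contradict
  -- the hypotheses; what remains spends the weight of one link from the budget. `¬ Crossing f e`
  -- puts the later link first, as the search does.
  bounded-total : ∀ {s u visited used b} vs → Bounded (List.length vs) s u visited used b →
    All (_∉ visited) vs → Unique vs →
    All (λ e → ¬ Any (Crossing e) used) (links s u vs) →
    AllPairs (λ e f → ¬ Crossing f e) (links s u vs) →
    total (links s u vs) ℚ.≤ b
  bounded-total [] (inj₁ crossing) _ _ (¬crossing ∷ _) _ = contradiction crossing ¬crossing
  bounded-total {b = b} [] (inj₂ w≤b) _ _ _ _ = subst (ℚ._≤ b) (sym (ℚ.+-identityʳ _)) w≤b
  bounded-total {s} {u} {visited} {used} {b} (v ∷ vs) bounded
    (v∉ ∷ vs∉) (v≢ ∷ unique) (¬used ∷ ¬useds) (¬crossing ∷ ¬crossings) with bounded v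
  ... | inj₁ v∈ = contradiction v∈ v∉
  ... | inj₂ (inj₁ crossing) = contradiction crossing ¬used
  ... | inj₂ (inj₂ bounded′) = begin
    w ℚ.+ total (links s v vs)  ≤⟨ ℚ.+-monoʳ-≤ w (bounded-total vs bounded′
      -- Distinctness from `v` extends avoidance of `visited`; below, not crossing the new link
      -- extends the condition on `used` likewise.
      (All.zipWith (λ { (v≢z , z∉) (here z≡v) → v≢z (sym z≡v)
                      ; (v≢z , z∉) (there z∈) → z∉ z∈ }) (v≢ , vs∉))
      unique
      (All.zipWith (λ { (¬c , ¬u) (here c)  → ¬c c
                      ; (¬c , ¬u) (there u) → ¬u u }) (¬crossing , ¬useds))
      ¬crossings) ⟩
    w ℚ.+ (b ℚ.- w)             ≡⟨ solve 2 (λ w b → w :+ (b :- w) := b) refl w b ⟩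
    b                           ∎
    where
    open ℚ.≤-Reasoning
    w = weight (u , v)

-- The pinwheel

-- At this scale integer bounds on the distances are precise enough.
hundredfold : ℤ → ℤ → ℚ²
hundredfold x y = + 100 ℤ.* x ℚ./ 1 , + 100 ℤ.* y ℚ./ 1

-- Index `zero` is the point to be left out. The others follow the hexagon: odd indices form the
-- inner triangle, the remaining even ones are the far points.
site : Fin 7 → ℚ²
site = Vec.lookup
  ( hundredfold (+ 0)      (+ 0)
  ∷ hundredfold (+ 1)      (+ 1)
  ∷ hundredfold (ℤ.- + 26) (ℤ.- + 12)
  ∷ hundredfold (ℤ.- + 1)  (+ 0)
  ∷ hundredfold (+ 22)     (ℤ.- + 12)
  ∷ hundredfold (+ 1)      (ℤ.- + 1)
  ∷ hundredfold (+ 2)      (+ 36)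
  ∷ [])

segment : Link 7 → Segment
segment (i , j) = site i , site j

crossings : CrossingTable 7
crossings = tabulateLinks λ e f → isYes (crosses? (segment e) (segment f))

-- The distances, rounded up to integers.
upper : Link 7 → ℚ
upper (i , j) = + Vec.lookup (Vec.lookup distances i) j ℚ./ 1
  where
  distances : Vec (Vec ℕ 7) 7
  distances =
      (   0 ∷  142 ∷ 2864 ∷  100 ∷ 2506 ∷  142 ∷ 3606 ∷ [])
    ∷ ( 142 ∷    0 ∷ 2997 ∷  224 ∷ 2470 ∷  200 ∷ 3502 ∷ [])
    ∷ (2864 ∷ 2997 ∷    0 ∷ 2774 ∷ 4800 ∷ 2916 ∷ 5557 ∷ [])
    ∷ ( 100 ∷  224 ∷ 2774 ∷    0 ∷ 2595 ∷  224 ∷ 3613 ∷ [])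
    ∷ (2506 ∷ 2470 ∷ 4800 ∷ 2595 ∷    0 ∷ 2371 ∷ 5200 ∷ [])
    ∷ ( 142 ∷  200 ∷ 2916 ∷  224 ∷ 2371 ∷    0 ∷ 3702 ∷ [])
    ∷ (3606 ∷ 3502 ∷ 5557 ∷ 3613 ∷ 5200 ∷ 3702 ∷    0 ∷ [])
    ∷ []

-- One less than the distance rounded down, to absorb the rounding of sqrtℚ.
lower : Link 7 → ℚ
lower e = upper e ℚ.- + 2 ℚ./ 1

-- Removing `zero` shifts indices by `suc` definitionally, so checks on these links apply directly
-- to the edges of `pinwheel`.
pinwheelLink : Fin 6 → Link 7
pinwheelLink i = suc i , suc (next i)

-- The rounded-up lengths of the six pinwheel edges sum to 17941; `lower` takes off 2 for each, and
-- one more unit is kept as the strict gap.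
bound : ℚ
bound = + 17928 ℚ./ 1

-- Finite verifications.

module _ (table : CrossingTable 7) where

  open Search table upper

  toursBounded? : Dec (∀ s → Bounded 6 s s (s ∷ []) [] bound)
  toursBounded? = all? λ s → bounded? 6 s s (s ∷ []) [] bound

open Search crossings upper

abstract

  -- Every start is searched, so that a tour can be followed from its own first vertex, with six
  -- more to visit. Opacity keeps the search from being evaluated again at its uses.
  toursBounded : ∀ s → Bounded 6 s s (s ∷ []) [] bound
  toursBounded = from-yes (toursBounded? crossings)

  site-injective : ∀ i j → site i ≡ site j → i ≡ j
  site-injective = from-yes (all? λ i → all? λ j →
    ≡-dec ℚ._≟_ ℚ._≟_ (site i) (site j) →-dec i Fin.≟ j)

  -- Nonparallelism is included because `Crosses` is blind to overlaps. Consecutive edges pass since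
  -- they meet in their common vertex, an endpoint of both.
  pinwheel-noncrossing : ∀ i j → i ≢ j →
    let e = segment (pinwheelLink i)
        f = segment (pinwheelLink j)
    in slant e f ≢ 0ℚ × ¬ Crosses e f
  pinwheel-noncrossing = from-yes (all? λ i → all? λ j →
    let e = segment (pinwheelLink i)
        f = segment (pinwheelLink j)
    in ¬? (i Fin.≟ j) →-dec (¬? (slant e f ℚ.≟ 0ℚ) ×-dec ¬? (crosses? e f)))

  dist²≤upper² : ∀ i j → 0ℚ ℚ.≤ upper (i , j) ×
    dist² (site i) (site j) ℚ.≤ upper (i , j) ℚ.* upper (i , j)
  dist²≤upper² = from-yes (all? λ i → all? λ j → 0ℚ ℚ.≤? upper (i , j) ×-dec
    dist² (site i) (site j) ℚ.≤? upper (i , j) ℚ.* upper (i , j))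

  lower²≤dist² : ∀ i → let (a , b) = pinwheelLink i ; l = lower (a , b) ℚ.+ 1ℚ in
    l ℚ.* l ℚ.≤ dist² (site a) (site b)
  lower²≤dist² = from-yes (all? λ i →
    let (a , b) = pinwheelLink i ; l = lower (a , b) ℚ.+ 1ℚ in
    l ℚ.* l ℚ.≤? dist² (site a) (site b))

  bound+1≤lower : bound ℚ.+ 1ℚ ℚ.≤ foldr ℚ._+_ 0ℚ (lower ∘ pinwheelLink)
  bound+1≤lower = from-yes (bound ℚ.+ 1ℚ ℚ.≤? foldr ℚ._+_ 0ℚ (lower ∘ pinwheelLink))

crossing⇒crosses : ∀ e f → Crossing e f → Crosses (segment e) (segment f)
crossing⇒crosses e f crossing = toWitness {a? = crosses? (segment e) (segment f)}
  (subst T (query-tabulateLinks (λ e f → isYes (crosses? (segment e) (segment f))) e f) crossing)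

edgeLength-≤ : ∀ k e → seq (edgeLength (embedˢ (segment e))) k ℚ.≤ upper e
edgeLength-≤ k (i , j) = sqrtℚ-≤ k (proj₁ (dist²≤upper² i j)) (proj₂ (dist²≤upper² i j))

-- Tours in the real plane and their lengths.

sites : PointSet 7
sites = record
  { point    = embed ∘ site
  ; distinct = λ {i} {j} → site-injective i j ∘ embed-injective (site i) (site j)
  }

pinwheel : Tour (sites ∖ zero)
pinwheel = record { 3≤n = ℕ.s≤s (ℕ.s≤s (ℕ.s≤s ℕ.z≤n)) ; order = Perm.id }

pinwheel-length : ∀ k → bound ℚ.+ 1ℚ ℚ.≤ seq (length pinwheel) k
pinwheel-length k = ℚ.≤-trans bound+1≤lower
  (≤-sum k (edgeLength ∘ Tour.edge pinwheel) (lower ∘ pinwheelLink) (λ i → ≤-sqrtℚ k (lower²≤dist² i)))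

module _ (tour : Tour sites) (noncrossing : Noncrossing tour) where

  private
    π : Fin 7 → Fin 7
    π = Tour.order tour ⟨$⟩ʳ_

    link : Fin 7 → Link 7
    link i = π i , π (next i)

    π-injective : ∀ {i j} → π i ≡ π j → i ≡ j
    π-injective πi≡πj = trans (sym (Perm.inverseˡ (Tour.order tour)))
      (trans (cong (Tour.order tour ⟨$⟩ˡ_) πi≡πj) (Perm.inverseˡ (Tour.order tour)))

    ¬crossing : ∀ {i j} → i ≢ j → ¬ Crossing (link j) (link i)
    ¬crossing {i} {j} i≢j crossing = crosses⇒¬noncrossing (segment (link j)) (segment (link i))
      (crossing⇒crosses (link j) (link i) crossing) (noncrossing j i (i≢j ∘ sym))

    -- As the size is the numeral 7, `List.tabulate link` computes to the `links` of the path from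
    -- `π zero`; `next` sends the last index to `zero`, which gives the closing link.
    link-total : total (List.tabulate link) ℚ.≤ bound
    link-total = bounded-total (List.tabulate (π ∘ suc)) (toursBounded (π zero))
      (All.tabulate⁺ λ { i (here eq) → contradiction (sym (π-injective {suc i} {zero} eq)) Fin.0≢1+n })
      (Unique.tabulate⁺ (Fin.suc-injective ∘ π-injective))
      (All.tabulate⁺ {f = link} λ _ ())
      (AllPairs.tabulate⁺ {f = link} ¬crossing)

  tour-length : ∀ k → seq (length tour) k ℚ.≤ bound
  tour-length k = ℚ.≤-trans
    (sum-≤ k (edgeLength ∘ Tour.edge tour) (upper ∘ link) (edgeLength-≤ k ∘ link))
    link-total

theorem2 : ∃[ n ] Σ[ X ∈ PointSet (suc n) ] Σ[ x ∈ Fin (suc n) ] Σ[ T ∈ Tour (X ∖ x) ]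
    (Noncrossing T × ((T′ : Tour X) → Noncrossing T′ → length T′ < length T))
theorem2 = 6 , sites , zero , pinwheel
  , (λ i j i≢j → let (nonparallel , ¬crosses) = pinwheel-noncrossing i j i≢j in
      ¬crosses⇒noncrossing (segment (pinwheelLink i)) (segment (pinwheelLink j)) nonparallel ¬crosses)
  -- The gap is 1 from index 0 on, since both length bounds hold at every index.
  , λ T′ noncrossing → 1ℚ , ℚ.positive⁻¹ 1ℚ , 0 , λ k _ →
      ℚ.≤-trans (ℚ.+-monoˡ-≤ 1ℚ (tour-length T′ noncrossing k)) (pinwheel-length k)
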